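{- For every nonnegative integer $n$ let $$W_n=\sum_{k=0}^{n}\binom{n+k}{2k}\binom{2k}{k}\frac{3}{2k-3}.$$ Let $n$ be a positive integer and let $p>3$ be a prime. Then $$9\sum_{k=0}^{n-1}(2k+1)W_k^2 \equiv 0 \pmod{n},$$ and $$\sum_{k=0}^{p-1}(2k+1)W_k^2 \equiv 12p(-1)^{\frac{p-1}{2}}-17p^2 \pmod{p^3}.$$
   Context: For every nonnegative integer $k$, $\binom{2k}{k}\frac{3}{2k-3}$ is an integer, so each $W_n$ is an integer. -}

module Defs where

open import Data.Nat as ℕ using (ℕ; zero; suc)
open import Data.Nat.Combinatorics using (_C_)
open import Data.Integer as ℤ using (ℤ; +_; -[1+_]; _+_; _-_; _*_; NonZero)
open import Data.Integer.DivMod using (_/_)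
open import Relation.Binary.PropositionalEquality using (_≡_; refl; cong)
open import Data.Nat.Properties using (+-suc)

den : ℕ → ℤ
den k = + (2 ℕ.* k) - + 3

-- 2k - 3 is never 0 (it is odd); needed as the divisor's NonZero instance
den-≡ : ∀ m → den (suc (suc m)) ≡ + suc (2 ℕ.* m)
den-≡ m rewrite +-suc m (suc (m ℕ.+ 0)) | +-suc m (m ℕ.+ 0) = refl

den-nonZero : ∀ k → NonZero (den k)
den-nonZero zero = _
den-nonZero (suc zero) = _
den-nonZero (suc (suc m)) rewrite den-≡ m = _

-- binom(2k,k) * 3 / (2k-3)  (an integer, exact division)
c : ℕ → ℤ
c k = (+ (((2 ℕ.* k) C k) ℕ.* 3) / den k) {{den-nonZero k}}

Wsum : ℕ → ℕ → ℤ
Wsum n zero = + ((n ℕ.+ 0) C 0) * c 0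
Wsum n (suc k) = Wsum n k + + ((n ℕ.+ suc k) C (2 ℕ.* suc k)) * c (suc k)

W : ℕ → ℤ
W n = Wsum n n

S : ℕ → ℤ
S zero = + 0
S (suc m) = S m + + (2 ℕ.* m ℕ.+ 1) * (W m * W m)

{-# OPTIONS --safe #-}

-- Put a(n,k) = C(n+k,2k) C(2k,k), let D n = Σ_k a(n,k) be the central Delannoy numbers, and let X n and n G n
-- be the sums over k < n of D k and of (2k+1) D k; both are again binomial sums.  Dividing
-- (k+1)² a(n,k+1) = (n-k)(n+k+1) a(n,k) by 2k+1 or by 2k-1 and summing over k lowers the denominator 2k+1
-- to 2k-1 and then to 2k-3, so 3 W n is a combination of X n, D n, G n with coefficients polynomial in n.
-- Induction then gives 18 Σ_{k<n} (2k+1) (W k)² = n · (a quadratic form in X n, D n, G n), which settles the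
-- first claim.  For n = p everything is governed by C(p-1,k) C(p+k,k) ≡ (-1)^k (mod p²): it yields
-- G p ≡ 1 (mod p), D p - G p ≡ 2 (mod p²) and, since the k-th and (p-1-k)-th terms of X p cancel modulo p²
-- unless 2k = p-1, also X p ≡ (-1)^((p-1)/2) (mod p²).

module Submission where

open import Defs
open import Data.Nat as ℕ using (ℕ; _≤_; _<_)
open import Data.Nat.Primality using (Prime)
open import Data.Integer as ℤ using (ℤ; +_; _+_; _-_; _*_; -1ℤ; _^_)
open import Data.Integer.Divisibility using (_∣_)
open import Data.Product using (_×_)

open import Data.Empty using (⊥-elim)
open import Data.Integer using (-_; 0ℤ; 1ℤ; NonZero; ∣_∣)
import Data.Integer.Divisibility.Signed as Signed
open Signed using (divides; ∣⇒∣ᵤ; ∣ᵤ⇒∣; ∣m∣n⇒∣m+n; ∣m∣n⇒∣m-n; ∣n⇒∣m*n; ∣-trans) renaming (_∣_ to _∣ₛ_)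
open import Data.Integer.DivMod using (_/_; _%_; a≡a%n+[a/n]*n; n%d<d)
open import Data.Integer.Properties
open import Data.Integer.Tactic.RingSolver using (solve-∀)
open import Data.Nat using (zero; suc; z≤n; s≤s)
open import Data.Nat.Combinatorics using (_C_; nC1≡n; nCk+nC[k+1]≡[n+1]C[k+1]; k>n⇒nCk≡0)
import Data.Nat.Divisibility as ℕ
open import Data.Nat.DivMod using (m≡m%n+[m/n]*n; m%n<n)
open import Data.Nat.Primality using (prime[2]; euclidsLemma; prime⇒nonZero; prime⇒irreducible)
import Data.Nat.Properties as ℕ
open import Data.Product using (_,_)
open import Data.Sum as Sum using (_⊎_; inj₁; inj₂; [_,_]′)
open import Function using (id; _∘_)
open import Relation.Binary.PropositionalEquality using (_≡_; refl; sym; trans; cong; cong₂; subst; subst₂; module ≡-Reasoning)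
open import Relation.Nullary using (¬_; yes; no)

-- Binomial coefficients

-- An equation l = r reduces to a ring identity once r is corrected by a multiple of a vanishing difference.
modulo : ∀ {A B l r} c → A ≡ B → l ≡ r + c * (A - B) → l ≡ r
modulo {A} {r = r} c refl eq = trans eq (vanish r c A)
  where
  vanish : ∀ r c A → r + c * (A - A) ≡ r
  vanish = solve-∀

modulo₂ : ∀ {A B A′ B′ l r} c c′ → A ≡ B → A′ ≡ B′ → l ≡ r + c * (A - B) + c′ * (A′ - B′) → l ≡ r
modulo₂ c c′ e e′ eq = modulo c e (modulo c′ e′ eq)

pascal : ∀ m j → + (suc m C suc j) ≡ + (m C j) + + (m C suc j)
pascal m j = cong +_ (sym (nCk+nC[k+1]≡[n+1]C[k+1] m j))

absorption : ∀ m j → + suc j * + (suc m C suc j) ≡ + suc m * + (m C j)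
absorption zero zero = refl
absorption zero (suc j) rewrite k>n⇒nCk≡0 {1} {suc (suc j)} (s≤s (s≤s z≤n)) = *-zeroʳ (+ suc (suc j))
absorption (suc m) zero = trans (cong (λ x → + 1 * + x) (nC1≡n (suc (suc m)))) (*-comm (+ 1) (+ suc (suc m)))
absorption (suc m) (suc j) =
  trans (cong (+ suc (suc j) *_) (pascal (suc m) (suc j)))
    (modulo₂ (+ 1) (+ 1) (absorption m j) (absorption m (suc j))
      (modulo (- (+ 1 + + m)) (pascal m j)
        (step (+ j) (+ m) (+ (m C j)) (+ (m C suc j)) (+ (suc m C suc j)) (+ (suc m C suc (suc j))))))
  where
  step : ∀ j m x y z t → (+ 2 + j) * (z + t)
    ≡ (+ 2 + m) * z + + 1 * ((+ 1 + j) * z - (+ 1 + m) * x) + + 1 * ((+ 2 + j) * t - (+ 1 + m) * y) + - (+ 1 + m) * (z - (x + y))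
  step = solve-∀

-- The subtraction is in ℤ, so the identity also covers j ≥ m, where both sides vanish.
absorption′ : ∀ m j → + suc j * + (m C suc j) ≡ (+ m - + j) * + (m C j)
absorption′ m j = modulo₂ (+ 1) (- (+ 1 + + j)) (absorption m j) (pascal m j)
    (step (+ j) (+ m) (+ (m C j)) (+ (m C suc j)) (+ (suc m C suc j)))
  where
  step : ∀ j m x y z → (+ 1 + j) * y ≡ (m - j) * x + + 1 * ((+ 1 + j) * z - (+ 1 + m) * x) + - (+ 1 + j) * (z - (x + y))
  step = solve-∀

2*suc : ∀ k → 2 ℕ.* suc k ≡ suc (suc (2 ℕ.* k))
2*suc k = cong suc (ℕ.+-suc k (k ℕ.+ 0))

central : ℕ → ℤ
central k = + ((2 ℕ.* k) C k)

-- Half of `central (suc k)`, see `central-suc`; with it `e` below is visibly an integer.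
half : ℕ → ℤ
half k = + (suc (2 ℕ.* k) C suc k)

half-central : ∀ k → (+ 1 + + k) * half k ≡ (+ 1 + + 2 * + k) * central k
half-central k = trans (absorption (2 ℕ.* k) k) (cong (λ x → (+ 1 + x) * central k) (pos-* 2 k))

central-suc : ∀ k → central (suc k) ≡ + 2 * half k
central-suc k = *-cancelˡ-≡ (+ suc k) _ _
    (trans (cong (λ i → + suc k * + (i C suc k)) (2*suc k))
      (modulo₂ (+ 1) (- + 2) (absorption (suc (2 ℕ.* k)) k) (absorption′ (suc (2 ℕ.* k)) k)
        (modulo (- lower) (pos-* 2 k)
          (step (+ k) (+ (2 ℕ.* k)) (+ (suc (suc (2 ℕ.* k)) C suc k)) lower (half k)))))
  where
  lower : ℤ
  lower = + (suc (2 ℕ.* k) C k)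
  step : ∀ k m z l h → (+ 1 + k) * z ≡ (+ 1 + k) * (+ 2 * h)
    + + 1 * ((+ 1 + k) * z - (+ 2 + m) * l) + - + 2 * ((+ 1 + k) * h - (+ 1 + m - k) * l) + - l * (m - + 2 * k)
  step = solve-∀

central-rec : ∀ k → (+ 1 + + k) * central (suc k) ≡ + 2 * (+ 1 + + 2 * + k) * central k
central-rec k = modulo₂ (+ 1 + + k) (+ 2) (central-suc k) (half-central k)
    (step (+ k) (central k) (half k) (central (suc k)))
  where
  step : ∀ k x h z → (+ 1 + k) * z ≡ + 2 * (+ 1 + + 2 * k) * x
    + (+ 1 + k) * (z - + 2 * h) + + 2 * ((+ 1 + k) * h - (+ 1 + + 2 * k) * x)
  step = solve-∀

-- The quotient of `central k` by 2k-1: it is -1 at 0 and twice the k-th Catalan number at `suc k`.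
-- The integral expression avoids a division.
quot : ℕ → ℤ
quot zero = -1ℤ
quot (suc k) = + 4 * central k - central (suc k)

quot-central : ∀ k → (+ 2 * + k - + 1) * quot k ≡ central k
quot-central zero = refl
quot-central (suc k) = modulo (- + 2) (central-rec k) (step (+ k) (central k) (central (suc k)))
  where
  step : ∀ k x z → (+ 2 * (+ 1 + k) - + 1) * (+ 4 * x - z)
    ≡ z + - + 2 * ((+ 1 + k) * z - + 2 * (+ 1 + + 2 * k) * x)
  step = solve-∀

-- The difference of the two quotients, times d, equals the remainder; the remainder is smaller than
-- the absolute value of d, so the difference is 0.
/-exact : ∀ a d q .{{_ : NonZero d}} → a ≡ q * d → a / d ≡ q
/-exact a d q eq = sym (i-j≡0⇒i≡j q (a / d) (∣i∣≡0⇒i≡0 (small ∣ q - a / d ∣ ∣ d ∣ bound)))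
  where
  remainder : (q - a / d) * d ≡ + (a % d)
  remainder = modulo₂ (- + 1) (+ 1) eq (a≡a%n+[a/n]*n a d) (step q (a / d) d a (+ (a % d)))
    where
    step : ∀ q f d a r → (q - f) * d ≡ r + - + 1 * (a - q * d) + + 1 * (a - (r + f * d))
    step = solve-∀
  bound : ∣ q - a / d ∣ ℕ.* ∣ d ∣ < ∣ d ∣
  bound = subst (_< ∣ d ∣) (trans (sym (cong ∣_∣ remainder)) (abs-* (q - a / d) d)) (n%d<d a d)
  small : ∀ m l → m ℕ.* l < l → m ≡ 0
  small zero l _ = refl
  small (suc m) l ml<l = ⊥-elim (ℕ.<⇒≱ ml<l (ℕ.m≤m+n l (m ℕ.* l)))

c-central : ∀ k → (+ 2 * + k - + 3) * c k ≡ + 3 * central k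
c-central zero = refl
c-central (suc k) = trans (cong ((+ 2 * + suc k - + 3) *_) c≡) scaled
  where
  value : ℤ
  -- By `central-rec`, 4(2k+1) `central k` = 2(k+1) `central (suc k)`. Multiplying `value` by 2k-1
  -- therefore leaves the factor 2(k+1) - (2k-1) = 3.
  value = (+ 1 + + 2 * + k) * (+ 4 * quot k - quot (suc k))
  scaled : (+ 2 * + suc k - + 3) * value ≡ + 3 * central (suc k)
  scaled = modulo₂ (+ 4 * (+ 1 + + 2 * + k)) (- (+ 2 * + k - + 1)) (quot-central k) (quot-central (suc k))
      (modulo (- + 2) (central-rec k) (step (+ k) (quot k) (quot (suc k)) (central k) (central (suc k))))
    where
    step : ∀ k q q′ x z → (+ 2 * (+ 1 + k) - + 3) * ((+ 1 + + 2 * k) * (+ 4 * q - q′)) ≡ + 3 * z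
      + + 4 * (+ 1 + + 2 * k) * ((+ 2 * k - + 1) * q - x)
      + - (+ 2 * k - + 1) * ((+ 2 * (+ 1 + k) - + 1) * q′ - z)
      + - + 2 * ((+ 1 + k) * z - + 2 * (+ 1 + + 2 * k) * x)
    step = solve-∀
  c≡ : c (suc k) ≡ value
  c≡ = /-exact (+ (((2 ℕ.* suc k) C suc k) ℕ.* 3)) (den (suc k)) value {{den-nonZero (suc k)}} (begin
    + (((2 ℕ.* suc k) C suc k) ℕ.* 3)  ≡⟨ pos-* ((2 ℕ.* suc k) C suc k) 3 ⟩
    central (suc k) * + 3              ≡⟨ *-comm (central (suc k)) (+ 3) ⟩
    + 3 * central (suc k)              ≡⟨ scaled ⟨
    (+ 2 * + suc k - + 3) * value      ≡⟨ *-comm (+ 2 * + suc k - + 3) value ⟩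
    value * (+ 2 * + suc k - + 3)      ≡⟨ cong (λ x → value * (x - + 3)) (pos-* 2 (suc k)) ⟨
    value * den (suc k)                ∎)
    where open ≡-Reasoning

-- The summands and their recurrences in n and k

ev : ℕ → ℕ → ℤ
ev n k = + ((n ℕ.+ k) C (2 ℕ.* k))

od : ℕ → ℕ → ℤ
od n k = + ((n ℕ.+ k) C suc (2 ℕ.* k))

ev-suc : ∀ n k → + 2 * (+ 1 + + k) * ev n (suc k) ≡ (+ 1 + (+ n + + k)) * od n k
ev-suc n k = begin
  + 2 * (+ 1 + + k) * ev n (suc k)                                  ≡⟨ cong₂ (λ x i → x * + (i C (2 ℕ.* suc k))) (sym (pos-* 2 (suc k))) (ℕ.+-suc n k) ⟩
  + (2 ℕ.* suc k) * + (suc (n ℕ.+ k) C (2 ℕ.* suc k))               ≡⟨ cong (λ i → + i * + (suc (n ℕ.+ k) C i)) (2*suc k) ⟩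
  + suc (suc (2 ℕ.* k)) * + (suc (n ℕ.+ k) C suc (suc (2 ℕ.* k)))   ≡⟨ absorption (n ℕ.+ k) (suc (2 ℕ.* k)) ⟩
  (+ 1 + (+ n + + k)) * od n k                                      ∎
  where open ≡-Reasoning

od-ev : ∀ n k → (+ 1 + + 2 * + k) * od n k ≡ (+ n - + k) * ev n k
od-ev n k = modulo₂ (+ 1) (- od n k - ev n k) (absorption′ (n ℕ.+ k) (2 ℕ.* k)) (pos-* 2 k)
    (step (+ n) (+ k) (+ (2 ℕ.* k)) (od n k) (ev n k))
  where
  step : ∀ n k m o e → (+ 1 + + 2 * k) * o
    ≡ (n - k) * e + + 1 * ((+ 1 + m) * o - (n + k - m) * e) + (- o - e) * (m - + 2 * k)
  step = solve-∀

od-step : ∀ n k → od (suc n) k ≡ ev n k + od n k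
od-step n k = pascal (n ℕ.+ k) (2 ℕ.* k)

ev-step : ∀ n k → ev (suc n) (suc k) ≡ od (suc n) k + ev n (suc k)
ev-step n k = begin
  + (suc (n ℕ.+ suc k) C (2 ℕ.* suc k))                                          ≡⟨ cong (λ i → + (suc (n ℕ.+ suc k) C i)) (2*suc k) ⟩
  + (suc (n ℕ.+ suc k) C suc (suc (2 ℕ.* k)))                                    ≡⟨ pascal (n ℕ.+ suc k) (suc (2 ℕ.* k)) ⟩
  + ((n ℕ.+ suc k) C suc (2 ℕ.* k)) + + ((n ℕ.+ suc k) C suc (suc (2 ℕ.* k)))    ≡⟨ cong₂ (λ i j → + (i C suc (2 ℕ.* k)) + + ((n ℕ.+ suc k) C j)) (ℕ.+-suc n k) (sym (2*suc k)) ⟩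
  od (suc n) k + ev n (suc k)                                                    ∎
  where open ≡-Reasoning

ev-vanishes : ∀ n → ev n (suc n) ≡ 0ℤ
ev-vanishes n = cong +_ (k>n⇒nCk≡0 (ℕ.+-mono-≤ (ℕ.n<1+n n) (ℕ.≤-reflexive (sym (ℕ.+-identityʳ (suc n))))))

od-vanishes : ∀ n → od n n ≡ 0ℤ
od-vanishes n = cong +_ (k>n⇒nCk≡0 (s≤s (ℕ.≤-reflexive (cong (n ℕ.+_) (sym (ℕ.+-identityʳ n))))))

-- As n varies with k fixed, `t n k` is the sum of `a j k` over j < n, and n times `e n k` is the
-- sum of (2j+1) `a j k`. In rational terms, `t`, `r` and `w` are `a` times (n-k)/(2k+1), 1/(2k-1)
-- and 3/(2k-3).
a t e r w : ℕ → ℕ → ℤ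
a n k = ev n k * central k
t n k = od n k * central k
e n k = od n k * half k
r n k = ev n k * quot k
w n k = ev n k * c k

a-e : ∀ n k → (+ 1 + + k) * a n (suc k) ≡ (+ 1 + (+ n + + k)) * e n k
a-e n k = modulo₂ ((+ 1 + + k) * ev n (suc k)) (half k) (central-suc k) (ev-suc n k)
    (step (+ n) (+ k) (ev n (suc k)) (central (suc k)) (half k) (od n k))
  where
  step : ∀ n k v b h o → (+ 1 + k) * (v * b) ≡ (+ 1 + (n + k)) * (o * h)
    + (+ 1 + k) * v * (b - + 2 * h) + h * (+ 2 * (+ 1 + k) * v - (+ 1 + (n + k)) * o)
  step = solve-∀

t-a : ∀ n k → (+ 1 + + 2 * + k) * t n k ≡ (+ n - + k) * a n k
t-a n k = modulo (central k) (od-ev n k) (step (+ n) (+ k) (ev n k) (central k) (od n k))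
  where
  step : ∀ n k v b o → (+ 1 + + 2 * k) * (o * b) ≡ (n - k) * (v * b) + b * ((+ 1 + + 2 * k) * o - (n - k) * v)
  step = solve-∀

e-t : ∀ n k → (+ 1 + + k) * e n k ≡ (+ 1 + + 2 * + k) * t n k
e-t n k = modulo (od n k) (half-central k) (step (+ k) (half k) (central k) (od n k))
  where
  step : ∀ k h b o → (+ 1 + k) * (o * h) ≡ (+ 1 + + 2 * k) * (o * b) + o * ((+ 1 + k) * h - (+ 1 + + 2 * k) * b)
  step = solve-∀

t-step : ∀ n k → t (suc n) k ≡ a n k + t n k
t-step n k = trans (cong (_* central k) (od-step n k)) (*-distribʳ-+ (central k) (ev n k) (od n k))

a-step : ∀ n k → a (suc n) (suc k) ≡ a n (suc k) + + 2 * e (suc n) k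
a-step n k = modulo₂ (central (suc k)) (od (suc n) k) (ev-step n k) (central-suc k)
    (step (ev (suc n) (suc k)) (od (suc n) k) (ev n (suc k)) (central (suc k)) (half k))
  where
  step : ∀ v′ o v b h → v′ * b ≡ v * b + + 2 * (o * h) + b * (v′ - (o + v)) + o * (b - + 2 * h)
  step = solve-∀

a-rec : ∀ n k → (+ 1 + + k) * a n (suc k) ≡ + n * e n k + (+ n - + k) * a n k
a-rec n k = modulo₂ (+ 1) (+ 1) (a-e n k) (e-t n k) (modulo (+ 1) (t-a n k)
    (step (+ n) (+ k) (a n (suc k)) (a n k) (t n k) (e n k)))
  where
  step : ∀ n k a′ a t e → (+ 1 + k) * a′ ≡ n * e + (n - k) * a
    + + 1 * ((+ 1 + k) * a′ - (+ 1 + (n + k)) * e) + + 1 * ((+ 1 + k) * e - (+ 1 + + 2 * k) * t)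
    + + 1 * ((+ 1 + + 2 * k) * t - (n - k) * a)
  step = solve-∀

a-rec² : ∀ n k → (+ 1 + + k) * (+ 1 + + k) * a n (suc k) ≡ (+ n - + k) * (+ 1 + (+ n + + k)) * a n k
a-rec² n k = modulo₂ (+ 1 + + k) (+ 1 + (+ n + + k)) (a-e n k) (e-t n k) (modulo (+ 1 + (+ n + + k)) (t-a n k)
    (step (+ n) (+ k) (a n (suc k)) (a n k) (t n k) (e n k)))
  where
  step : ∀ n k a′ a t e → (+ 1 + k) * (+ 1 + k) * a′ ≡ (n - k) * (+ 1 + (n + k)) * a
    + (+ 1 + k) * ((+ 1 + k) * a′ - (+ 1 + (n + k)) * e) + (+ 1 + (n + k)) * ((+ 1 + k) * e - (+ 1 + + 2 * k) * t)
    + (+ 1 + (n + k)) * ((+ 1 + + 2 * k) * t - (n - k) * a)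
  step = solve-∀

e-step : ∀ n k → (+ 1 + + n) * e (suc n) k ≡ + n * e n k + (+ 1 + + 2 * + n) * a n k
e-step n k = *-cancelˡ-≡ (+ suc k) _ _
    (modulo₂ ((+ 1 + + k) * ((+ 1 + + n) * half k)) ((+ 1 + + n) * ev n k) (od-step n k) (half-central k)
      (modulo₂ (+ 1) (+ 1) (e-t n k) (t-a n k)
        (step (+ n) (+ k) (ev n k) (od n k) (od (suc n) k) (central k) (half k))))
  where
  step : ∀ n k v o o′ b h → (+ 1 + k) * ((+ 1 + n) * (o′ * h)) ≡ (+ 1 + k) * (n * (o * h) + (+ 1 + + 2 * n) * (v * b))
    + (+ 1 + k) * ((+ 1 + n) * h) * (o′ - (v + o)) + (+ 1 + n) * v * ((+ 1 + k) * h - (+ 1 + + 2 * k) * b)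
    + + 1 * ((+ 1 + k) * (o * h) - (+ 1 + + 2 * k) * (o * b)) + + 1 * ((+ 1 + + 2 * k) * (o * b) - (n - k) * (v * b))
  step = solve-∀

r-a : ∀ n k → (+ 2 * + k - + 1) * r n k ≡ a n k
r-a n k = modulo (ev n k) (quot-central k) (step (+ k) (ev n k) (quot k) (central k))
  where
  step : ∀ k v q b → (+ 2 * k - + 1) * (v * q) ≡ v * b + v * ((+ 2 * k - + 1) * q - b)
  step = solve-∀

w-a : ∀ n k → (+ 2 * + k - + 3) * w n k ≡ + 3 * a n k
w-a n k = modulo (ev n k) (c-central k) (step (+ k) (ev n k) (c k) (central k))
  where
  step : ∀ k v q b → (+ 2 * k - + 3) * (v * q) ≡ + 3 * (v * b) + v * ((+ 2 * k - + 3) * q - + 3 * b)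
  step = solve-∀

odd-nonZero : ∀ k → NonZero (+ 1 + + 2 * + k)
odd-nonZero k rewrite sym (pos-* 2 k) = _

odd′-nonZero : ∀ k → NonZero (+ 2 * + k - + 1)
odd′-nonZero zero = _
odd′-nonZero (suc k) rewrite sym (pos-* 2 (suc k)) | ℕ.+-suc k (k ℕ.+ 0) = _

-- This is four times `a-rec²` divided by 2k+1. On the left, 4(k+1)² = (2k+1)(2k+3) + 1, and the
-- remainder 1 produces `r n (suc k)`. On the right, (n-k) `a n k` / (2k+1) is `t n k`, and 4(n+k+1)
-- = (4n+2) + 2(2k+1).
r-rec : ∀ n k → + 2 * (+ suc k * a n (suc k)) + + 1 * a n (suc k) + + 1 * r n (suc k)
  ≡ (+ 2 + + 4 * + n) * t n k + + 2 * + n * a n k + - + 2 * (+ k * a n k)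
r-rec n k = *-cancelˡ-≡ (+ 1 + + 2 * + k) _ _ {{odd-nonZero k}}
    (modulo₂ (+ 1) (- (+ 2 + + 4 * + n)) (r-a n (suc k)) (t-a n k) (modulo (+ 4) (a-rec² n k)
      (step (+ n) (+ k) (a n (suc k)) (a n k) (t n k) (r n (suc k)))))
  where
  step : ∀ n k a′ a t r′ → (+ 1 + + 2 * k) * (+ 2 * ((+ 1 + k) * a′) + + 1 * a′ + + 1 * r′)
    ≡ (+ 1 + + 2 * k) * ((+ 2 + + 4 * n) * t + + 2 * n * a + - + 2 * (k * a))
    + + 1 * ((+ 2 * (+ 1 + k) - + 1) * r′ - a′) + - (+ 2 + + 4 * n) * ((+ 1 + + 2 * k) * t - (n - k) * a)
    + + 4 * ((+ 1 + k) * (+ 1 + k) * a′ - (n - k) * (+ 1 + (n + k)) * a)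
  step = solve-∀

-- The same division by 2k-1: here 4(k+1)² = (2k-1)(2k+5) + 9, and 4(n-k)(n+k+1) = 4n(n+1) - 3 -
-- (2k-1)(2k+3).
w-rec : ∀ n k → + 2 * (+ suc k * a n (suc k)) + + 3 * a n (suc k) + + 3 * w n (suc k)
  ≡ (+ 4 * (+ n * (+ 1 + + n)) - + 3) * r n k + - + 3 * a n k + - + 2 * (+ k * a n k)
w-rec n k = *-cancelˡ-≡ (+ 2 * + k - + 1) _ _ {{odd′-nonZero k}}
    (modulo₂ (+ 3) (- (+ 4 * (+ n * (+ 1 + + n)) - + 3)) (w-a n (suc k)) (r-a n k) (modulo (+ 4) (a-rec² n k)
      (step (+ n) (+ k) (a n (suc k)) (a n k) (r n k) (w n (suc k)))))
  where
  step : ∀ n k a′ a r w′ → (+ 2 * k - + 1) * (+ 2 * ((+ 1 + k) * a′) + + 3 * a′ + + 3 * w′)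
    ≡ (+ 2 * k - + 1) * ((+ 4 * (n * (+ 1 + n)) - + 3) * r + - + 3 * a + - + 2 * (k * a))
    + + 3 * ((+ 2 * (+ 1 + k) - + 3) * w′ - + 3 * a′) + - (+ 4 * (n * (+ 1 + n)) - + 3) * ((+ 2 * k - + 1) * r - a)
    + + 4 * ((+ 1 + k) * (+ 1 + k) * a′ - (n - k) * (+ 1 + (n + k)) * a)
  step = solve-∀

-- Finite sums and a closed form for W

sum : (ℕ → ℤ) → ℕ → ℤ
sum f zero = 0ℤ
sum f (suc m) = sum f m + f m

sum-cong : ∀ {f g} → (∀ k → f k ≡ g k) → ∀ m → sum f m ≡ sum g m
sum-cong f≗g zero = refl
sum-cong f≗g (suc m) = cong₂ _+_ (sum-cong f≗g m) (f≗g m)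

sum-linear₃ : ∀ α β γ f g h m →
  sum (λ k → α * f k + β * g k + γ * h k) m ≡ α * sum f m + β * sum g m + γ * sum h m
sum-linear₃ α β γ f g h zero = zeros α β γ
  where
  zeros : ∀ α β γ → 0ℤ ≡ α * 0ℤ + β * 0ℤ + γ * 0ℤ
  zeros = solve-∀
sum-linear₃ α β γ f g h (suc m) =
  trans (cong (_+ (α * f m + β * g m + γ * h m)) (sum-linear₃ α β γ f g h m))
    (regroup α β γ (sum f m) (sum g m) (sum h m) (f m) (g m) (h m))
  where
  regroup : ∀ α β γ F G H f g h → α * F + β * G + γ * H + (α * f + β * g + γ * h)
    ≡ α * (F + f) + β * (G + g) + γ * (H + h)
  regroup = solve-∀

sum-linear₂ : ∀ α β f g m → sum (λ k → α * f k + β * g k) m ≡ α * sum f m + β * sum g m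
sum-linear₂ α β f g zero = zeros α β
  where
  zeros : ∀ α β → 0ℤ ≡ α * 0ℤ + β * 0ℤ
  zeros = solve-∀
sum-linear₂ α β f g (suc m) =
  trans (cong (_+ (α * f m + β * g m)) (sum-linear₂ α β f g m)) (regroup α β (sum f m) (sum g m) (f m) (g m))
  where
  regroup : ∀ α β F G f g → α * F + β * G + (α * f + β * g) ≡ α * (F + f) + β * (G + g)
  regroup = solve-∀

sum-suc : ∀ f m → sum f (suc m) ≡ f 0 + sum (f ∘ suc) m
sum-suc f zero = +-comm 0ℤ (f 0)
sum-suc f (suc m) = trans (cong (_+ f (suc m)) (sum-suc f m)) (+-assoc (f 0) (sum (f ∘ suc) m) (f (suc m)))

sum-snoc-zero : ∀ f m → f m ≡ 0ℤ → sum f (suc m) ≡ sum f m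
sum-snoc-zero f m fm≡0 = trans (cong (_+_ (sum f m)) fm≡0) (+-identityʳ (sum f m))

sum-shift : ∀ f m → f 0 ≡ 0ℤ → f m ≡ 0ℤ → sum (f ∘ suc) m ≡ sum f m
sum-shift f m f0≡0 fm≡0 = begin
  sum (f ∘ suc) m        ≡⟨ +-identityˡ (sum (f ∘ suc) m) ⟨
  0ℤ + sum (f ∘ suc) m   ≡⟨ cong (_+ sum (f ∘ suc) m) f0≡0 ⟨
  f 0 + sum (f ∘ suc) m  ≡⟨ sum-suc f m ⟨
  sum f (suc m)          ≡⟨ sum-snoc-zero f m fm≡0 ⟩
  sum f m                ∎
  where open ≡-Reasoning

-- `X` and `G` stop one term earlier because `od n n` is 0; so `X (suc n)` and `G (suc n)` have as
-- many terms as `D n` and can be compared with it termwise.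
D X G R M : ℕ → ℤ
D n = sum (a n) (suc n)
X n = sum (t n) n
G n = sum (e n) n
R n = sum (r n) (suc n)
M n = sum (λ k → + k * a n k) (suc n)

ev-vanishes-* : ∀ n x → ev n (suc n) * x ≡ 0ℤ
ev-vanishes-* n x = trans (cong (_* x) (ev-vanishes n)) (*-zeroˡ x)

od-vanishes-* : ∀ n x → od n n * x ≡ 0ℤ
od-vanishes-* n x = trans (cong (_* x) (od-vanishes n)) (*-zeroˡ x)

W-sum : ∀ n → W n ≡ sum (w n) (suc n)
W-sum n = go n
  where
  go : ∀ m → Wsum n m ≡ sum (w n) (suc m)
  go zero = sym (+-identityˡ (w n 0))
  go (suc m) = cong (_+ w n (suc m)) (go m)

X-extended : ∀ n → sum (t n) (suc n) ≡ X n
X-extended n = sum-snoc-zero (t n) n (od-vanishes-* n (central n))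

G-extended : ∀ n → sum (e n) (suc n) ≡ G n
G-extended n = sum-snoc-zero (e n) n (od-vanishes-* n (half n))

-- Together with `G-suc` and `D-suc` this is a first-order system for X, D, G, which drives the
-- induction for `S`.
X-suc : ∀ n → X (suc n) ≡ X n + D n
X-suc n = begin
  X (suc n)                                              ≡⟨ sum-cong (λ k → trans (t-step n k) (ones (a n k) (t n k))) (suc n) ⟩
  sum (λ k → + 1 * t n k + + 1 * a n k) (suc n)          ≡⟨ sum-linear₂ (+ 1) (+ 1) (t n) (a n) (suc n) ⟩
  + 1 * sum (t n) (suc n) + + 1 * D n                    ≡⟨ ones (D n) (sum (t n) (suc n)) ⟨
  D n + sum (t n) (suc n)                                ≡⟨ cong (_+_ (D n)) (X-extended n) ⟩
  D n + X n                                              ≡⟨ +-comm (D n) (X n) ⟩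
  X n + D n                                              ∎
  where
  open ≡-Reasoning
  ones : ∀ x y → x + y ≡ + 1 * y + + 1 * x
  ones = solve-∀

G-suc : ∀ n → (+ 1 + + n) * G (suc n) ≡ + n * G n + (+ 1 + + 2 * + n) * D n
G-suc n = begin
  (+ 1 + + n) * G (suc n)                                                ≡⟨ pad (+ 1 + + n) (G (suc n)) ⟩
  (+ 1 + + n) * G (suc n) + 0ℤ * G (suc n)                               ≡⟨ sum-linear₂ (+ 1 + + n) 0ℤ (e (suc n)) (e (suc n)) (suc n) ⟨
  sum (λ k → (+ 1 + + n) * e (suc n) k + 0ℤ * e (suc n) k) (suc n)       ≡⟨ sum-cong (λ k → trans (sym (pad (+ 1 + + n) (e (suc n) k))) (e-step n k)) (suc n) ⟩
  sum (λ k → + n * e n k + (+ 1 + + 2 * + n) * a n k) (suc n)            ≡⟨ sum-linear₂ (+ n) (+ 1 + + 2 * + n) (e n) (a n) (suc n) ⟩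
  + n * sum (e n) (suc n) + (+ 1 + + 2 * + n) * D n                      ≡⟨ cong (λ x → + n * x + (+ 1 + + 2 * + n) * D n) (G-extended n) ⟩
  + n * G n + (+ 1 + + 2 * + n) * D n                                    ∎
  where
  open ≡-Reasoning
  pad : ∀ x y → x * y ≡ x * y + 0ℤ * y
  pad = solve-∀

D-suc : ∀ n → D (suc n) ≡ D n + + 2 * G (suc n)
D-suc n = begin
  D (suc n)                                                                        ≡⟨ sum-suc (a (suc n)) (suc n) ⟩
  a (suc n) 0 + sum (a (suc n) ∘ suc) (suc n)                                      ≡⟨ cong (_+_ (a (suc n) 0)) (sum-cong (λ k → trans (a-step n k) (one (a n (suc k)) (+ 2 * e (suc n) k))) (suc n)) ⟩
  a n 0 + sum (λ k → + 1 * a n (suc k) + + 2 * e (suc n) k) (suc n)                ≡⟨ cong (_+_ (a n 0)) (sum-linear₂ (+ 1) (+ 2) (a n ∘ suc) (e (suc n)) (suc n)) ⟩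
  a n 0 + (+ 1 * sum (a n ∘ suc) (suc n) + + 2 * G (suc n))                        ≡⟨ regroup (a n 0) (sum (a n ∘ suc) (suc n)) (+ 2 * G (suc n)) ⟩
  a n 0 + sum (a n ∘ suc) (suc n) + + 2 * G (suc n)                                ≡⟨ cong (_+ + 2 * G (suc n)) (sum-suc (a n) (suc n)) ⟨
  sum (a n) (suc (suc n)) + + 2 * G (suc n)                                        ≡⟨ cong (_+ + 2 * G (suc n)) (sum-snoc-zero (a n) (suc n) (ev-vanishes-* n (central (suc n)))) ⟩
  D n + + 2 * G (suc n)                                                            ∎
  where
  open ≡-Reasoning
  one : ∀ x y → x + y ≡ + 1 * x + y
  one = solve-∀
  regroup : ∀ x y z → x + (+ 1 * y + z) ≡ x + y + z
  regroup = solve-∀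

-- Shifting k by one turns the weighted sum into a combination containing its own negative. It
-- amounts to 2 M = n (G + D), kept in this form to avoid halving.
M-eq : ∀ n → M n ≡ + n * G n + + n * D n + - + 1 * M n
M-eq n = begin
  M n                                                                       ≡⟨ sum-shift (λ k → + k * a n k) (suc n) (*-zeroˡ (a n 0)) (trans (cong (+ suc n *_) (ev-vanishes-* n (central (suc n)))) (*-zeroʳ (+ suc n))) ⟨
  sum (λ k → + suc k * a n (suc k)) (suc n)                                 ≡⟨ sum-cong (λ k → trans (a-rec n k) (expand (+ n) (+ k) (e n k) (a n k))) (suc n) ⟩
  sum (λ k → + n * e n k + + n * a n k + - + 1 * (+ k * a n k)) (suc n)     ≡⟨ sum-linear₃ (+ n) (+ n) (- + 1) (e n) (a n) (λ k → + k * a n k) (suc n) ⟩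
  + n * sum (e n) (suc n) + + n * D n + - + 1 * M n                         ≡⟨ cong (λ x → + n * x + + n * D n + - + 1 * M n) (G-extended n) ⟩
  + n * G n + + n * D n + - + 1 * M n                                       ∎
  where
  open ≡-Reasoning
  expand : ∀ n k e a → n * e + (n - k) * a ≡ n * e + n * a + - + 1 * (k * a)
  expand = solve-∀

-- The left sides of `r-rec` and `w-rec` are taken at `suc k`. Shifting the index back costs nothing
-- when the combined summand vanishes at 0 and at n+1; at 0 this holds because `a n 0` is 1 while
-- `r n 0` and `w n 0` are -1.
shifted-linear : ∀ n α f → α * a n 0 + α * f 0 ≡ 0ℤ → f (suc n) ≡ 0ℤ →
  sum (λ k → + 2 * (+ suc k * a n (suc k)) + α * a n (suc k) + α * f (suc k)) (suc n)
  ≡ + 2 * M n + α * D n + α * sum f (suc n)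
shifted-linear n α f first last = trans
    (sum-shift (λ k → + 2 * (+ k * a n k) + α * a n k + α * f k) (suc n)
      (trans (drop (a n 0) (α * a n 0) (α * f 0)) first)
      (trans (cong₂ (λ x y → + 2 * (+ suc n * x) + α * x + α * y) (ev-vanishes-* n (central (suc n))) last) (zeros (+ suc n) α)))
    (sum-linear₃ (+ 2) α α (λ k → + k * a n k) (a n) f (suc n))
  where
  drop : ∀ x y z → + 2 * (0ℤ * x) + y + z ≡ y + z
  drop = solve-∀
  zeros : ∀ n α → + 2 * (n * 0ℤ) + α * 0ℤ + α * 0ℤ ≡ 0ℤ
  zeros = solve-∀

R-eq : ∀ n → + 2 * M n + + 1 * D n + + 1 * R n ≡ (+ 2 + + 4 * + n) * X n + + 2 * + n * D n + - + 2 * M n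
R-eq n = begin
  + 2 * M n + + 1 * D n + + 1 * R n
    ≡⟨ shifted-linear n (+ 1) (r n) refl (ev-vanishes-* n (quot (suc n))) ⟨
  sum (λ k → + 2 * (+ suc k * a n (suc k)) + + 1 * a n (suc k) + + 1 * r n (suc k)) (suc n)
    ≡⟨ sum-cong (r-rec n) (suc n) ⟩
  sum (λ k → (+ 2 + + 4 * + n) * t n k + + 2 * + n * a n k + - + 2 * (+ k * a n k)) (suc n)
    ≡⟨ sum-linear₃ (+ 2 + + 4 * + n) (+ 2 * + n) (- + 2) (t n) (a n) (λ k → + k * a n k) (suc n) ⟩
  (+ 2 + + 4 * + n) * sum (t n) (suc n) + + 2 * + n * D n + - + 2 * M n
    ≡⟨ cong (λ x → (+ 2 + + 4 * + n) * x + + 2 * + n * D n + - + 2 * M n) (X-extended n) ⟩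
  (+ 2 + + 4 * + n) * X n + + 2 * + n * D n + - + 2 * M n
    ∎
  where open ≡-Reasoning

W-eq : ∀ n → + 2 * M n + + 3 * D n + + 3 * W n ≡ (+ 4 * (+ n * (+ 1 + + n)) - + 3) * R n + - + 3 * D n + - + 2 * M n
W-eq n = begin
  + 2 * M n + + 3 * D n + + 3 * W n
    ≡⟨ cong (λ x → + 2 * M n + + 3 * D n + + 3 * x) (W-sum n) ⟩
  + 2 * M n + + 3 * D n + + 3 * sum (w n) (suc n)
    ≡⟨ shifted-linear n (+ 3) (w n) refl (ev-vanishes-* n (c (suc n))) ⟨
  sum (λ k → + 2 * (+ suc k * a n (suc k)) + + 3 * a n (suc k) + + 3 * w n (suc k)) (suc n)
    ≡⟨ sum-cong (w-rec n) (suc n) ⟩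
  sum (λ k → (+ 4 * (+ n * (+ 1 + + n)) - + 3) * r n k + - + 3 * a n k + - + 2 * (+ k * a n k)) (suc n)
    ≡⟨ sum-linear₃ (+ 4 * (+ n * (+ 1 + + n)) - + 3) (- + 3) (- + 2) (r n) (a n) (λ k → + k * a n k) (suc n) ⟩
  (+ 4 * (+ n * (+ 1 + + n)) - + 3) * R n + - + 3 * D n + - + 2 * M n
    ∎
  where open ≡-Reasoning

3W : ℤ → ℤ → ℤ → ℤ → ℤ
3W n X D G = (+ 4 * (n * (+ 1 + n)) - + 3) * ((+ 2 + + 4 * n) * X - D - + 2 * n * G) - (+ 6 + + 2 * n) * D - + 2 * n * G

-- Linear elimination: `R-eq` removes R from `W-eq`, and M then enters only through 2 M, which
-- `M-eq` supplies.
W-closed : ∀ n → + 3 * W n ≡ 3W (+ n) (X n) (D n) (G n)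
W-closed n = modulo₂ (+ 1) (+ 4 * (+ n * (+ 1 + + n)) - + 3) (W-eq n) (R-eq n)
    (modulo (- + 2 * (+ 1 + + 4 * (+ n * (+ 1 + + n)) - + 3)) (M-eq n) (step (+ n) (X n) (D n) (G n) (R n) (M n) (W n)))
  where
  step : ∀ n X D G R M W → + 3 * W ≡ ((+ 4 * (n * (+ 1 + n)) - + 3) * ((+ 2 + + 4 * n) * X - D - + 2 * n * G) - (+ 6 + + 2 * n) * D - + 2 * n * G)
    + + 1 * (+ 2 * M + + 3 * D + + 3 * W - ((+ 4 * (n * (+ 1 + n)) - + 3) * R + - + 3 * D + - + 2 * M))
    + (+ 4 * (n * (+ 1 + n)) - + 3) * (+ 2 * M + + 1 * D + + 1 * R - ((+ 2 + + 4 * n) * X + + 2 * n * D + - + 2 * M))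
    + - + 2 * (+ 1 + + 4 * (n * (+ 1 + n)) - + 3) * (M - (n * G + n * D + - + 1 * M))
  step = solve-∀

-- The closed form for S

-- Evaluated at y = (R n + R (n - 1)) / 2 and z = (R n - R (n - 1)) / 2; in these coordinates
-- the antidifference of (2n + 1) (W n)² has polynomial coefficients.
form : ℤ → ℤ → ℤ → ℤ → ℤ
form n y z g = + 8 * (n * n * n) * ((n * y - + 2 * z - g) * (n * y - + 2 * z - g))
  - + 24 * (n * n) * (y * (n * y - + 2 * z - g)) + + 72 * (n * n) * (y * z)
  - + 9 * n * (y * y) + + 18 * n * (z * z) - + 72 * n * (z * g) - + 54 * y * (z + g)

quadratic : ℤ → ℤ → ℤ → ℤ → ℤ
quadratic n X D G = n * form n (+ 2 * n * (+ 2 * X - G) - (D - G)) (+ 2 * X - G) G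

-- Every solution of (n+1) G′ = n G + (2n+1) D has the shape G′ = D + n t, G = (n+1) t - D.
quadratic-suc : ∀ n X D t → quadratic (+ 1 + n) (X + D) (D + + 2 * (D + n * t)) (D + n * t)
  ≡ quadratic n X D ((+ 1 + n) * t - D)
    + + 2 * (+ 2 * n + + 1) * (3W n X D ((+ 1 + n) * t - D) * 3W n X D ((+ 1 + n) * t - D))
quadratic-suc = identity
  where
  identity : ∀ n X D t →
    let form′ : ℤ → ℤ → ℤ → ℤ → ℤ
        form′ n y z g = + 8 * (n * n * n) * ((n * y - + 2 * z - g) * (n * y - + 2 * z - g))
          - + 24 * (n * n) * (y * (n * y - + 2 * z - g)) + + 72 * (n * n) * (y * z)
          - + 9 * n * (y * y) + + 18 * n * (z * z) - + 72 * n * (z * g) - + 54 * y * (z + g)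
        quadratic′ : ℤ → ℤ → ℤ → ℤ → ℤ
        quadratic′ n X D G = n * form′ n (+ 2 * n * (+ 2 * X - G) - (D - G)) (+ 2 * X - G) G
        G = (+ 1 + n) * t - D
        3W′ = (+ 4 * (n * (+ 1 + n)) - + 3) * ((+ 2 + + 4 * n) * X - D - + 2 * n * G) - (+ 6 + + 2 * n) * D - + 2 * n * G
    in quadratic′ (+ 1 + n) (X + D) (D + + 2 * (D + n * t)) (D + n * t)
      ≡ quadratic′ n X D G + + 2 * (+ 2 * n + + 1) * (3W′ * 3W′)
  identity = solve-∀

S-closed : ∀ n → + 18 * S n ≡ quadratic (+ n) (X n) (D n) (G n)
S-closed zero = refl
S-closed (suc n) = begin
  + 18 * (S n + + (2 ℕ.* n ℕ.+ 1) * (W n * W n))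
    ≡⟨ cong (λ x → + 18 * (S n + (x + + 1) * (W n * W n))) (pos-* 2 n) ⟩
  + 18 * (S n + (+ 2 * + n + + 1) * (W n * W n))
    ≡⟨ regroup (+ n) (S n) (W n) ⟩
  + 18 * S n + + 2 * (+ 2 * + n + + 1) * (+ 3 * W n * (+ 3 * W n))
    ≡⟨ cong₂ (λ x y → x + + 2 * (+ 2 * + n + + 1) * (y * y)) (S-closed n) (W-closed n) ⟩
  quadratic (+ n) (X n) (D n) (G n) + + 2 * (+ 2 * + n + + 1) * (3W (+ n) (X n) (D n) (G n) * 3W (+ n) (X n) (D n) (G n))
    ≡⟨ cong (λ g → quadratic (+ n) (X n) (D n) g + + 2 * (+ 2 * + n + + 1) * (3W (+ n) (X n) (D n) g * 3W (+ n) (X n) (D n) g)) G≡ ⟩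
  quadratic (+ n) (X n) (D n) ((+ 1 + + n) * τ - D n)
    + + 2 * (+ 2 * + n + + 1) * (3W (+ n) (X n) (D n) ((+ 1 + + n) * τ - D n) * 3W (+ n) (X n) (D n) ((+ 1 + + n) * τ - D n))
    ≡⟨ quadratic-suc (+ n) (X n) (D n) τ ⟨
  quadratic (+ suc n) (X n + D n) (D n + + 2 * (D n + + n * τ)) (D n + + n * τ)
    ≡⟨ cong (λ g → quadratic (+ suc n) (X n + D n) (D n + + 2 * g) g) G′≡ ⟨
  quadratic (+ suc n) (X n + D n) (D n + + 2 * G (suc n)) (G (suc n))
    ≡⟨ cong₂ (λ x d → quadratic (+ suc n) x d (G (suc n))) (X-suc n) (D-suc n) ⟨
  quadratic (+ suc n) (X (suc n)) (D (suc n)) (G (suc n))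
    ∎
  where
  open ≡-Reasoning
  τ : ℤ
  -- This is the t of `quadratic-suc`: subtracting G = (n+1) t - D from G′ = D + n t gives G′ - G =
  -- 2 D - t, which yields t without a division.
  τ = + 2 * D n + G n - G (suc n)
  regroup : ∀ n s w → + 18 * (s + (+ 2 * n + + 1) * (w * w)) ≡ + 18 * s + + 2 * (+ 2 * n + + 1) * (+ 3 * w * (+ 3 * w))
  regroup = solve-∀
  G≡ : G n ≡ (+ 1 + + n) * τ - D n
  G≡ = modulo (+ 1) (G-suc n) (step (+ n) (D n) (G n) (G (suc n)))
    where
    step : ∀ n D G G′ → G ≡ (+ 1 + n) * (+ 2 * D + G - G′) - D + + 1 * ((+ 1 + n) * G′ - (n * G + (+ 1 + + 2 * n) * D))
    step = solve-∀
  G′≡ : G (suc n) ≡ D n + + n * τ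
  G′≡ = modulo (+ 1) (G-suc n) (step (+ n) (D n) (G n) (G (suc n)))
    where
    step : ∀ n D G G′ → G′ ≡ D + n * (+ 2 * D + G - G′) + + 1 * ((+ 1 + n) * G′ - (n * G + (+ 1 + + 2 * n) * D))
    step = solve-∀
 

-- Divisibility by n

prime-∣-* : ∀ {p} x y → Prime p → + p ∣ₛ x * y → (+ p ∣ₛ x) ⊎ (+ p ∣ₛ y)
prime-∣-* x y pr p∣xy =
  Sum.map ∣ᵤ⇒∣ ∣ᵤ⇒∣ (euclidsLemma ∣ x ∣ ∣ y ∣ pr (subst (_ ℕ.∣_) (abs-* x y) (∣⇒∣ᵤ p∣xy)))

-- Half of `form` once -9 n y², its only term with an odd coefficient, is left out.
evenPart : ℤ → ℤ → ℤ → ℤ → ℤ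
evenPart n y z g = + 4 * (n * n * n) * ((n * y - + 2 * z - g) * (n * y - + 2 * z - g))
  - + 12 * (n * n) * (y * (n * y - + 2 * z - g)) + + 36 * (n * n) * (y * z)
  + + 9 * n * (z * z) - + 36 * n * (z * g) - + 27 * y * (z + g)

form-evenPart : ∀ n y z g → form n y z g ≡ + 2 * evenPart n y z g - + 9 * n * (y * y)
form-evenPart n y z g = identity n y z g (n * y - + 2 * z - g)
  where
  identity : ∀ n y z g ψ →
    + 8 * (n * n * n) * (ψ * ψ) - + 24 * (n * n) * (y * ψ) + + 72 * (n * n) * (y * z)
      - + 9 * n * (y * y) + + 18 * n * (z * z) - + 72 * n * (z * g) - + 54 * y * (z + g)
    ≡ + 2 * (+ 4 * (n * n * n) * (ψ * ψ) - + 12 * (n * n) * (y * ψ) + + 36 * (n * n) * (y * z)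
      + + 9 * n * (z * z) - + 36 * n * (z * g) - + 27 * y * (z + g)) - + 9 * n * (y * y)
  identity = solve-∀

-- 18 S n = n (2 K - 9 n y²) forces n y to be even, and then the factor 2 cancels.
n∣9S : ∀ n → + n ∣ₛ + 9 * S n
n∣9S n = divides (K - + 9 * y * j) (*-cancelˡ-≡ (+ 2) _ _
    (modulo₂ (+ 1) (- + 9 * + n * y) 18S ny≡j*2 (halve (+ n) y K (S n) j)))
  where
  z y K : ℤ
  z = + 2 * X n - G n
  y = + 2 * + n * z - (D n - G n)
  K = evenPart (+ n) y z (G n)
  18S : + 18 * S n ≡ + n * (+ 2 * K - + 9 * + n * (y * y))
  18S = trans (S-closed n) (cong (+ n *_) (form-evenPart (+ n) y z (G n)))
  2∣ny : + 2 ∣ₛ + n * y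
  -- The equation `18S` reads 9 (n y)² = 2 (n K - 9 S). Subtracting 8 (n y)² shows that the square
  -- of n y is even, and 2 is prime.
  2∣ny = [ id , id ]′ (prime-∣-* (+ n * y) (+ n * y) prime[2]
      (divides (+ n * K - + 9 * S n - + 4 * (+ n * y * (+ n * y))) (modulo (+ 1) 18S (even (+ n) y K (S n)))))
    where
    even : ∀ n y K s → n * y * (n * y) ≡ (n * K - + 9 * s - + 4 * (n * y * (n * y))) * + 2
      + + 1 * (+ 18 * s - n * (+ 2 * K - + 9 * n * (y * y)))
    even = solve-∀
  j : ℤ
  j = Signed._∣_.quotient 2∣ny
  ny≡j*2 : + n * y ≡ j * + 2
  ny≡j*2 = Signed._∣_.equality 2∣ny
  halve : ∀ n y K s j → + 2 * (+ 9 * s) ≡ + 2 * ((K - + 9 * y * j) * n)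
    + + 1 * (+ 18 * s - n * (+ 2 * K - + 9 * n * (y * y))) + - + 9 * n * y * (n * y - j * + 2)
  halve = solve-∀

-- Cancellation modulo prime powers and sums with one surviving term

-- Euclid's lemma puts one factor p into y; cancelling it on both sides lowers the exponent, and the
-- induction continues with the cofactor. This replaces inverses modulo a prime power.
prime-power-cancel : ∀ {p x} i y → Prime p → ¬ (+ p ∣ₛ x) → (+ p) ^ i ∣ₛ x * y → (+ p) ^ i ∣ₛ y
prime-power-cancel zero y pr p∤x _ = divides y (sym (*-identityʳ y))
prime-power-cancel {p} {x} (suc i) y pr p∤x (divides q xy≡) with prime-∣-* x y pr (divides (q * (+ p) ^ i) (trans xy≡ (rotate q (+ p) ((+ p) ^ i))))
  where
  rotate : ∀ q p z → q * (p * z) ≡ q * z * p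
  rotate = solve-∀
... | inj₁ p∣x = ⊥-elim (p∤x p∣x)
... | inj₂ (divides y′ y≡) with prime-power-cancel {p} {x} i y′ pr p∤x (divides q (*-cancelˡ-≡ (+ p) _ _ {{prime⇒nonZero pr}}
        (modulo₂ (+ 1) (- x) xy≡ y≡ (step x y y′ q (+ p) ((+ p) ^ i)))))
  where
  step : ∀ x y y′ q p z → p * (x * y′) ≡ p * (q * z) + + 1 * (x * y - q * (p * z)) + - x * (y - y′ * p)
  step = solve-∀
... | divides q′ y′≡ = divides q′ (modulo₂ (+ 1) (+ p) y≡ y′≡ (step y y′ q′ (+ p) ((+ p) ^ i)))
  where
  step : ∀ y y′ q′ p z → y ≡ q′ * (p * z) + + 1 * (y - y′ * p) + p * (y′ - q′ * z)
  step = solve-∀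

sum-∣ : ∀ {d} f m → (∀ k → k < m → d ∣ₛ f k) → d ∣ₛ sum f m
sum-∣ f zero d∣f = divides 0ℤ refl
sum-∣ f (suc m) d∣f = ∣m∣n⇒∣m+n (sum-∣ f m (λ k k<m → d∣f k (ℕ.m<n⇒m<1+n k<m))) (d∣f m (ℕ.n<1+n m))

sum-single : ∀ {d} f m h → h < m → (∀ k → k < m → ¬ k ≡ h → d ∣ₛ f k) → d ∣ₛ sum f m - f h
sum-single {d} f (suc m) h h<1+m d∣f with m ℕ.≟ h
... | yes refl = subst (d ∣ₛ_) (cancel (sum f m) (f m)) (sum-∣ f m (λ k k<m → d∣f k (ℕ.m<n⇒m<1+n k<m) (ℕ.<⇒≢ k<m)))
  where
  cancel : ∀ x y → x ≡ x + y - y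
  cancel = solve-∀
... | no m≢h = subst (d ∣ₛ_) (swap (sum f m) (f h) (f m))
    (∣m∣n⇒∣m+n (sum-single f m h (ℕ.≤∧≢⇒< (ℕ.≤-pred h<1+m) (m≢h ∘ sym)) (λ k k<m → d∣f k (ℕ.m<n⇒m<1+n k<m))) (d∣f m (ℕ.n<1+n m) m≢h))
  where
  swap : ∀ x y z → x - y + z ≡ x + z - y
  swap = solve-∀

sum-reverse : ∀ f m → sum f (suc m) ≡ sum (λ k → f (m ℕ.∸ k)) (suc m)
sum-reverse f zero = refl
sum-reverse f (suc m) = begin
  sum f (suc m) + f (suc m)                        ≡⟨ cong (_+ f (suc m)) (sum-reverse f m) ⟩
  sum (λ k → f (m ℕ.∸ k)) (suc m) + f (suc m)      ≡⟨ +-comm (sum (λ k → f (m ℕ.∸ k)) (suc m)) (f (suc m)) ⟩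
  f (suc m) + sum (λ k → f (m ℕ.∸ k)) (suc m)      ≡⟨ sum-suc (λ k → f (suc m ℕ.∸ k)) (suc m) ⟨
  sum (λ k → f (suc m ℕ.∸ k)) (suc (suc m))        ∎
  where open ≡-Reasoning

-- The congruence modulo p³

u : ℕ → ℕ → ℤ
u m k = + (m C k) * + ((suc m ℕ.+ k) C k)

-- With p = m+1 the factor on the right is p² - (k+1)², so modulo p² each step multiplies by -1
-- after (k+1)² is cancelled.
u-rec : ∀ m k → (+ 1 + + k) * (+ 1 + + k) * u m (suc k)
  ≡ (+ suc m - (+ 1 + + k)) * (+ suc m + (+ 1 + + k)) * u m k
u-rec m k = trans (cong (λ i → (+ 1 + + k) * (+ 1 + + k) * (+ (m C suc k) * + (i C suc k))) (ℕ.+-suc (suc m) k))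
    (modulo₂ ((+ 1 + + k) * y′) ((+ m - + k) * x) (absorption′ m k) (absorption (suc m ℕ.+ k) k) (step (+ m) (+ k) x x′ y y′))
  where
  x x′ y y′ : ℤ
  x = + (m C k)
  x′ = + (m C suc k)
  y = + ((suc m ℕ.+ k) C k)
  y′ = + (suc (suc m ℕ.+ k) C suc k)
  step : ∀ m k x x′ y y′ → (+ 1 + k) * (+ 1 + k) * (x′ * y′)
    ≡ (+ 1 + m - (+ 1 + k)) * (+ 1 + m + (+ 1 + k)) * (x * y)
      + (+ 1 + k) * y′ * ((+ 1 + k) * x′ - (m - k) * x) + (m - k) * x * ((+ 1 + k) * y′ - (+ 1 + (+ 1 + m + k)) * y)
  step = solve-∀

u-a : ∀ m k → + suc m * u m k ≡ (+ suc m - + k) * a (suc m) k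
u-a m zero = cong (_* 1ℤ) (sym (+-identityʳ (+ suc m)))
u-a m (suc k) = *-cancelˡ-≡ (+ suc k) _ _ (*-cancelˡ-≡ (+ suc k) _ _
    (modulo₂ (+ suc m) (- (+ suc m - + suc k)) (u-rec m k) (a-rec² (suc m) k)
      (modulo ((+ suc m - + suc k) * (+ suc m + + suc k)) (u-a m k)
        (step (+ suc m) (+ k) (u m k) (u m (suc k)) (a (suc m) k) (a (suc m) (suc k))))))
  where
  step : ∀ n k u u′ a a′ → (+ 1 + k) * ((+ 1 + k) * (n * u′)) ≡ (+ 1 + k) * ((+ 1 + k) * ((n - (+ 1 + k)) * a′))
    + n * ((+ 1 + k) * (+ 1 + k) * u′ - (n - (+ 1 + k)) * (n + (+ 1 + k)) * u)
    + - (n - (+ 1 + k)) * ((+ 1 + k) * (+ 1 + k) * a′ - (n - k) * (+ 1 + (n + k)) * a)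
    + (n - (+ 1 + k)) * (n + (+ 1 + k)) * (n * u - (n - k) * a)
  step = solve-∀

-- For n = p = m+1 the numerator has the factor p. In the range k ≤ m it can be lost only where p
-- divides the denominator: at 2k+1 = p here, and at k+1 = p in `e-u`.
t-u : ∀ m k → (+ 1 + + 2 * + k) * t (suc m) k ≡ + suc m * u m k
t-u m k = trans (t-a (suc m) k) (sym (u-a m k))

e-u : ∀ m k → (+ 1 + + k) * e (suc m) k ≡ + suc m * u m k
e-u m k = trans (e-t (suc m) k) (t-u m k)

-- Matching the (k+1)-st term of D with the k-th term of G gains a second factor n over k+1, see
-- `b-e`. Hence D - G is accessible modulo p², although G is controlled only modulo p.
b : ℕ → ℕ → ℤ
b n k = a n (suc k) - e n k

b-e : ∀ n k → (+ 1 + + k) * b n k ≡ + n * e n k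
b-e n k = modulo (+ 1) (a-e n k) (step (+ n) (+ k) (a n (suc k)) (e n k))
  where
  step : ∀ n k a′ e → (+ 1 + k) * (a′ - e) ≡ n * e + + 1 * ((+ 1 + k) * a′ - (+ 1 + (n + k)) * e)
  step = solve-∀

D-G : ∀ n → D n - G n ≡ + 1 + sum (b n) n
D-G n = begin
  D n - G n                                                    ≡⟨ cong (_- G n) (sum-suc (a n) n) ⟩
  + 1 + sum (a n ∘ suc) n - G n                                ≡⟨ regroup (sum (a n ∘ suc) n) (G n) ⟩
  + 1 + (+ 1 * sum (a n ∘ suc) n + - + 1 * G n)                ≡⟨ cong (_+_ (+ 1)) (sum-linear₂ (+ 1) (- + 1) (a n ∘ suc) (e n) n) ⟨
  + 1 + sum (λ k → + 1 * a n (suc k) + - + 1 * e n k) n        ≡⟨ cong (_+_ (+ 1)) (sum-cong (λ k → simplify (a n (suc k)) (e n k)) n) ⟩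
  + 1 + sum (b n) n                                            ∎
  where
  open ≡-Reasoning
  regroup : ∀ x y → + 1 + x - y ≡ + 1 + (+ 1 * x + - + 1 * y)
  regroup = solve-∀
  simplify : ∀ x y → + 1 * x + - + 1 * y ≡ x - y
  simplify = solve-∀

-- `high` gathers the terms of `form` that carry n². As `quadratic` has one further factor n, only
-- `low` matters modulo n³.
high low : ℤ → ℤ → ℤ → ℤ → ℤ
high n y z g = + 8 * n * ((n * y - + 2 * z - g) * (n * y - + 2 * z - g))
  - + 24 * (y * (n * y - + 2 * z - g)) + + 72 * (y * z)
low n y z g = - + 9 * n * (y * y) + + 18 * n * (z * z) - + 72 * n * (z * g) - + 54 * y * (z + g)

form-split : ∀ n y z g → form n y z g ≡ high n y z g * n ^ 2 + low n y z g
form-split n y z g = identity n y z g (n * y - + 2 * z - g)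
  where
  identity : ∀ n y z g ψ →
    + 8 * (n * n * n) * (ψ * ψ) - + 24 * (n * n) * (y * ψ) + + 72 * (n * n) * (y * z)
      - + 9 * n * (y * y) + + 18 * n * (z * z) - + 72 * n * (z * g) - + 54 * y * (z + g)
    ≡ (+ 8 * n * (ψ * ψ) - + 24 * (y * ψ) + + 72 * (y * z)) * (n * (n * 1ℤ))
      + (- + 9 * n * (y * y) + + 18 * n * (z * z) - + 72 * n * (z * g) - + 54 * y * (z + g))
  identity = solve-∀

-- Knowing G modulo p is enough: z + G is exactly 2 X, and everywhere else G is multiplied by p.
-- With z = 2 ε - 1, G = 1 and y = 2 p z - 2 the terms in p ε cancel, leaving 216 ε - 306 p.
low-mod : ∀ p X G s ε → ε * ε ≡ 1ℤ → p ^ 2 ∣ₛ X - ε → p ∣ₛ G - 1ℤ → p ^ 2 ∣ₛ s - + 2 →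
  p ^ 2 ∣ₛ low p (+ 2 * p * (+ 2 * X - G) - s) (+ 2 * X - G) G - + 18 * (+ 12 * ε - + 17 * p)
low-mod p X G s ε ε²≡1 (divides α X≡) (divides β G≡) (divides γ s≡) = substituted
    (modulo (+ 1) X≡ (shift² X ε α p)) (modulo (+ 1) G≡ (shift G β p)) (modulo (+ 1) s≡ (shift² s (+ 2) γ p))
  where
  shift : ∀ x q p → x ≡ 1ℤ + p * q + + 1 * (x - 1ℤ - q * p)
  shift = solve-∀
  shift² : ∀ x s q p → x ≡ s + p * p * q + + 1 * (x - s - q * (p * (p * 1ℤ)))
  shift² = solve-∀
  quotient : ℤ
  quotient =
    let x = ε + p * p * α
        z = + 2 * x - (1ℤ + p * β)
        v = + 2 * z - p * γ
        ξ = + 2 * p * α - β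
    in + 108 * (γ * x + + 2 * α) - + 216 * p * z * α + + 36 * v - + 9 * p * (v * v)
      + + 18 * (+ 2 * (+ 2 * ε - + 1) * ξ + p * (ξ * ξ)) - + 72 * ξ - + 72 * z * β - + 216 * ξ * ε
  -- Only ε² = 1 is used beyond ring laws. Its coefficient is -360 p: 72 p from 18 p z² and -432 p
  -- from -54 y (z + g).
  expand : ∀ p ε α β γ →
    let x = ε + p * p * α
        g = 1ℤ + p * β
        z = + 2 * x - g
        y = + 2 * p * z - (+ 2 + p * p * γ)
        v = + 2 * z - p * γ
        ξ = + 2 * p * α - β
    in - + 9 * p * (y * y) + + 18 * p * (z * z) - + 72 * p * (z * g) - + 54 * y * (z + g) - + 18 * (+ 12 * ε - + 17 * p)
      ≡ (+ 108 * (γ * x + + 2 * α) - + 216 * p * z * α + + 36 * v - + 9 * p * (v * v)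
          + + 18 * (+ 2 * (+ 2 * ε - + 1) * ξ + p * (ξ * ξ)) - + 72 * ξ - + 72 * z * β - + 216 * ξ * ε)
        * (p * (p * 1ℤ)) + - + 360 * p * (ε * ε - 1ℤ)
  expand = solve-∀
  substituted : ∀ {X G s} → X ≡ ε + p * p * α → G ≡ 1ℤ + p * β → s ≡ + 2 + p * p * γ →
    p ^ 2 ∣ₛ low p (+ 2 * p * (+ 2 * X - G) - s) (+ 2 * X - G) G - + 18 * (+ 12 * ε - + 17 * p)
  substituted refl refl refl = divides quotient (modulo (- + 360 * p) ε²≡1 (expand p ε α β γ))

quadratic-mod : ∀ p X D G ε → ε * ε ≡ 1ℤ → p ^ 2 ∣ₛ X - ε → p ∣ₛ G - 1ℤ → p ^ 2 ∣ₛ D - G - + 2 →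
  p ^ 3 ∣ₛ quadratic p X D G - + 18 * (+ 12 * p * ε - + 17 * p ^ 2)
quadratic-mod p X D G ε ε²≡1 X≡ε G≡1 s≡2 with low-mod p X G (D - G) ε ε²≡1 X≡ε G≡1 s≡2
... | divides q low≡ = divides (high p y z G + q)
    (trans (cong (λ f → p * f - + 18 * (+ 12 * p * ε - + 17 * p ^ 2)) (form-split p y z G))
      (modulo p low≡ (step p ε q (high p y z G) (low p y z G))))
  where
  z y : ℤ
  z = + 2 * X - G
  y = + 2 * p * z - (D - G)
  step : ∀ p ε q h l → p * (h * (p * (p * 1ℤ)) + l) - + 18 * (+ 12 * p * ε - + 17 * (p * (p * 1ℤ)))
    ≡ (h + q) * (p * (p * (p * 1ℤ))) + p * (l - + 18 * (+ 12 * ε - + 17 * p) - q * (p * (p * 1ℤ)))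
  step = solve-∀

-- Residues of G, D and X at n = p, where p = m + 1

module _ (m : ℕ) (pr : Prime (suc m)) (3<p : 3 < suc m) where

  p : ℤ
  p = + suc m

  p∣⇒≤ : ∀ i → p ∣ₛ + suc i → m ≤ i
  p∣⇒≤ i p∣i = ℕ.≤-pred (ℕ.∣⇒≤ (∣⇒∣ᵤ p∣i))

  p∤suc : ∀ k → k < m → ¬ (p ∣ₛ + suc k)
  p∤suc k k<m p∣ = ℕ.<⇒≱ k<m (p∣⇒≤ k p∣)

  p∤2 : ¬ (p ∣ₛ + 2)
  p∤2 p∣2 = ℕ.<⇒≱ (ℕ.≤-trans (s≤s (s≤s z≤n)) (ℕ.≤-pred 3<p)) (p∣⇒≤ 1 p∣2)

  p∤3 : ¬ (p ∣ₛ + 3)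
  p∤3 p∣3 = ℕ.<⇒≱ (ℕ.≤-pred 3<p) (p∣⇒≤ 2 p∣3)

  p∤18 : ¬ (p ∣ₛ + 18)
  p∤18 p∣18 = [ p∤2 , (λ p∣9 → [ p∤3 , p∤3 ]′ (prime-∣-* (+ 3) (+ 3) pr p∣9)) ]′ (prime-∣-* (+ 2) (+ 9) pr p∣18)

  h : ℕ
  h = m ℕ./ 2

  m≡2h : m ≡ 2 ℕ.* h
  m≡2h with m ℕ.% 2 | m≡m%n+[m/n]*n m 2 | m%n<n m 2
  ... | 0 | eq | _ = trans eq (ℕ.*-comm h 2)
  ... | 1 | eq | _ = ⊥-elim (contra (prime⇒irreducible pr (ℕ.divides (suc h) (cong suc eq))))
    where
    contra : ¬ (2 ≡ 1 ⊎ 2 ≡ suc m)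
    contra (inj₂ 2≡p) = ℕ.<⇒≱ 3<p (subst (_≤ 3) 2≡p (s≤s (s≤s z≤n)))
  ... | suc (suc _) | _ | s≤s (s≤s ())

  2h+1≡p : + 1 + + 2 * + h ≡ p
  2h+1≡p = cong (λ x → + 1 + x) (trans (sym (pos-* 2 h)) (cong +_ (sym m≡2h)))

  -- Since 2k+1 ≤ 2m+1 < 2p, the only multiple of p it could be is p itself, which means k = h.
  p∤odd : ∀ k → k ≤ m → ¬ k ≡ h → ¬ (p ∣ₛ + 1 + + 2 * + k)
  p∤odd k k≤m k≢h p∣ with ∣⇒∣ᵤ (subst (λ x → p ∣ₛ + 1 + x) (sym (pos-* 2 k)) p∣)
  ... | ℕ.divides 1 eq = k≢h (ℕ.*-cancelˡ-≡ k h 2 (trans (ℕ.suc-injective (trans eq (ℕ.+-identityʳ (suc m)))) m≡2h))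
  ... | ℕ.divides (suc (suc q)) eq = ℕ.<⇒≱ (ℕ.n<1+n (2 ℕ.* m))
        (ℕ.≤-pred (ℕ.≤-trans big (ℕ.+-monoʳ-≤ 1 (ℕ.*-monoʳ-≤ 2 k≤m))))
    where
    big : suc (suc (2 ℕ.* m)) ≤ suc (2 ℕ.* k)
    big = subst₂ _≤_ (2*suc m) (sym eq) (ℕ.*-monoˡ-≤ (suc m) (s≤s (s≤s (z≤n {q}))))

  σ : ℕ → ℤ
  σ k = -1ℤ ^ k

  σ²≡1 : ∀ k → σ k * σ k ≡ 1ℤ
  σ²≡1 zero = refl
  σ²≡1 (suc k) = trans (square (σ k)) (σ²≡1 k)
    where
    square : ∀ x → -1ℤ * x * (-1ℤ * x) ≡ x * x
    square = solve-∀

  σ-double : ∀ k → σ (2 ℕ.* k) ≡ 1ℤ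
  σ-double k = trans (cong (λ i → σ (k ℕ.+ i)) (ℕ.+-identityʳ k)) (trans (^-distribˡ-+-* -1ℤ k k) (σ²≡1 k))

  σm≡1 : σ m ≡ 1ℤ
  σm≡1 = trans (cong σ m≡2h) (σ-double h)

  σ-complement : ∀ k → k ≤ m → σ (m ℕ.∸ k) ≡ σ k
  σ-complement k k≤m = begin
    σ (m ℕ.∸ k)                    ≡⟨ *-identityʳ (σ (m ℕ.∸ k)) ⟨
    σ (m ℕ.∸ k) * 1ℤ               ≡⟨ cong (σ (m ℕ.∸ k) *_) (σ²≡1 k) ⟨
    σ (m ℕ.∸ k) * (σ k * σ k)      ≡⟨ *-assoc (σ (m ℕ.∸ k)) (σ k) (σ k) ⟨
    σ (m ℕ.∸ k) * σ k * σ k        ≡⟨ cong (_* σ k) (^-distribˡ-+-* -1ℤ (m ℕ.∸ k) k) ⟨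
    σ (m ℕ.∸ k ℕ.+ k) * σ k        ≡⟨ cong (λ i → σ i * σ k) (ℕ.m∸n+n≡m k≤m) ⟩
    σ m * σ k                      ≡⟨ cong (_* σ k) σm≡1 ⟩
    1ℤ * σ k                       ≡⟨ *-identityˡ (σ k) ⟩
    σ k                            ∎
    where open ≡-Reasoning

  -- By `u-rec`, (k+1)² times the sum of consecutive terms is p² `u m k`. As k+1 < p, both factors
  -- k+1 cancel, so each term is the negative of the previous one modulo p².
  u-sign : ∀ k → k ≤ m → p ^ 2 ∣ₛ u m k - σ k
  u-sign zero _ = divides 0ℤ refl
  u-sign (suc k) k<m = subst (p ^ 2 ∣ₛ_) (regroup (u m (suc k)) (u m k) (σ k))
      (∣m∣n⇒∣m-n (prime-power-cancel 2 _ pr (p∤suc k k<m) (prime-power-cancel 2 _ pr (p∤suc k k<m)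
          (divides (u m k) (modulo (+ 1) (u-rec m k) (step p (+ k) (u m k) (u m (suc k)))))))
        (u-sign k (ℕ.<⇒≤ k<m)))
    where
    regroup : ∀ u′ u s → u′ + u - (u - s) ≡ u′ - -1ℤ * s
    regroup = solve-∀
    step : ∀ p k u u′ → (+ 1 + k) * ((+ 1 + k) * (u′ + u)) ≡ u * (p * (p * 1ℤ))
      + + 1 * ((+ 1 + k) * (+ 1 + k) * u′ - (p - (+ 1 + k)) * (p + (+ 1 + k)) * u)
    step = solve-∀

  u-m : p ^ 2 ∣ₛ u m m - 1ℤ
  u-m = subst (λ s → p ^ 2 ∣ₛ u m m - s) σm≡1 (u-sign m ℕ.≤-refl)

  p∣p² : p ∣ₛ p ^ 2
  p∣p² = divides p (cong (p *_) (*-identityʳ p))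

  *-∣-p² : ∀ {x} → p ∣ₛ x → p ^ 2 ∣ₛ p * x
  *-∣-p² (divides q refl) = divides q (step p q)
    where
    step : ∀ p q → p * (q * p) ≡ q * (p * (p * 1ℤ))
    step = solve-∀

  cancel-p : ∀ {x} y → ¬ (p ∣ₛ x) → p ∣ₛ x * y → p ∣ₛ y
  cancel-p {x} y p∤x p∣xy = [ ⊥-elim ∘ p∤x , id ]′ (prime-∣-* x y pr p∣xy)

  p∣p* : ∀ x → p ∣ₛ p * x
  p∣p* x = divides x (*-comm p x)

  p∣e : ∀ k → k < m → p ∣ₛ e (suc m) k
  p∣e k k<m = cancel-p _ (p∤suc k k<m) (subst (p ∣ₛ_) (sym (e-u m k)) (p∣p* (u m k)))

  e-m : e (suc m) m ≡ u m m
  e-m = *-cancelˡ-≡ p _ _ (e-u m m)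

  -- Only k = m survives: there the denominator k+1 equals p and cancels the factor p, leaving
  -- `u m m`.
  G-mod : p ∣ₛ G (suc m) - 1ℤ
  G-mod = subst (p ∣ₛ_) (sym (+-assoc (sum (e (suc m)) m) (e (suc m) m) (- 1ℤ)))
    (∣m∣n⇒∣m+n (sum-∣ (e (suc m)) m p∣e) (subst (λ x → p ∣ₛ x - 1ℤ) (sym e-m) (∣-trans p∣p² u-m)))

  p²∣b : ∀ k → k < m → p ^ 2 ∣ₛ b (suc m) k
  p²∣b k k<m = prime-power-cancel 2 _ pr (p∤suc k k<m) (subst (p ^ 2 ∣ₛ_) (sym (b-e (suc m) k)) (*-∣-p² (p∣e k k<m)))

  b-m : b (suc m) m ≡ u m m
  b-m = trans (*-cancelˡ-≡ p _ _ (b-e (suc m) m)) e-m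

  -- The residue 2 is the k = 0 term of D plus the last term of `b`, which is `u m m`; all other
  -- terms contain p².
  D-G-mod : p ^ 2 ∣ₛ D (suc m) - G (suc m) - + 2
  D-G-mod = subst (p ^ 2 ∣ₛ_) (trans (regroup (sum (b (suc m)) m) (b (suc m) m)) (cong (_- + 2) (sym (D-G (suc m)))))
      (∣m∣n⇒∣m+n (sum-∣ (b (suc m)) m p²∣b) (subst (λ x → p ^ 2 ∣ₛ x - 1ℤ) (sym b-m) u-m))
    where
    regroup : ∀ x y → x + (y - 1ℤ) ≡ + 1 + (x + y) - + 2
    regroup = solve-∀

  -- For k′ = m - k the denominators 2k+1 and 2k′+1 add up to 2p, so (2k+1)(t + t′) = p (u - u′ + 2
  -- t′). The bracket is divisible by p: u and u′ have the same sign because m is even, and p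
  -- divides t′ because k′ is not h.
  t-pair : ∀ k → k ≤ m → ¬ k ≡ h → p ^ 2 ∣ₛ t (suc m) k + t (suc m) (m ℕ.∸ k)
  t-pair k k≤m k≢h = prime-power-cancel 2 _ pr (p∤odd k k≤m k≢h)
      (subst (p ^ 2 ∣ₛ_) (sym combine) (*-∣-p² (∣m∣n⇒∣m+n p∣u-u′ (∣n⇒∣m*n (+ 2) p∣t′))))
    where
    k′ : ℕ
    k′ = m ℕ.∸ k
    k′≤m : k′ ≤ m
    k′≤m = ℕ.m∸n≤m m k
    k+k′≡m : + k + + k′ ≡ + m
    k+k′≡m = cong +_ (ℕ.m+[n∸m]≡n k≤m)
    k′≢h : ¬ k′ ≡ h
    k′≢h k′≡h = k≢h (ℕ.+-cancelʳ-≡ h k h (begin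
      k ℕ.+ h        ≡⟨ cong (k ℕ.+_) k′≡h ⟨
      k ℕ.+ k′       ≡⟨ ℕ.m+[n∸m]≡n k≤m ⟩
      m              ≡⟨ m≡2h ⟩
      2 ℕ.* h        ≡⟨ cong (h ℕ.+_) (ℕ.+-identityʳ h) ⟩
      h ℕ.+ h        ∎))
      where open ≡-Reasoning
    p∣t′ : p ∣ₛ t (suc m) k′
    p∣t′ = cancel-p _ (p∤odd k′ k′≤m k′≢h) (subst (p ∣ₛ_) (sym (t-u m k′)) (p∣p* (u m k′)))
    p∣u-u′ : p ∣ₛ u m k - u m k′
    p∣u-u′ = ∣-trans p∣p² (subst (p ^ 2 ∣ₛ_) (trans (cong (λ s → u m k - σ k - (u m k′ - s)) (σ-complement k k≤m)) (telescope (u m k) (u m k′) (σ k)))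
        (∣m∣n⇒∣m-n (u-sign k k≤m) (u-sign k′ k′≤m)))
      where
      telescope : ∀ x y s → x - s - (y - s) ≡ x - y
      telescope = solve-∀
    combine : (+ 1 + + 2 * + k) * (t (suc m) k + t (suc m) k′) ≡ p * (u m k - u m k′ + + 2 * t (suc m) k′)
    combine = modulo₂ (+ 1) (- + 1) (t-u m k) (t-u m k′)
        (modulo (+ 2 * t (suc m) k′) k+k′≡m (step (+ m) (+ k) (+ k′) (t (suc m) k) (t (suc m) k′) (u m k) (u m k′)))
      where
      step : ∀ m k k′ t t′ u u′ → (+ 1 + + 2 * k) * (t + t′) ≡ (+ 1 + m) * (u - u′ + + 2 * t′)
        + + 1 * ((+ 1 + + 2 * k) * t - (+ 1 + m) * u) + - + 1 * ((+ 1 + + 2 * k′) * t′ - (+ 1 + m) * u′)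
        + + 2 * t′ * (k + k′ - m)
      step = solve-∀

  t-h : t (suc m) h ≡ u m h
  t-h = *-cancelˡ-≡ p _ _ (trans (cong (_* t (suc m) h) (sym 2h+1≡p)) (t-u m h))

  h≤m : h ≤ m
  h≤m = subst (h ≤_) (sym m≡2h) (ℕ.m≤m+n h (h ℕ.+ 0))

  m∸h≡h : m ℕ.∸ h ≡ h
  m∸h≡h = trans (cong (ℕ._∸ h) (trans m≡2h (cong (h ℕ.+_) (ℕ.+-identityʳ h)))) (ℕ.m+n∸n≡m h h)

  -- Adding X to its reversal pairs k with m - k. The middle index is its own partner and
  -- contributes 2 `u m h`, since 2h+1 = p there; the factor 2 cancels at the end.
  X-mod : p ^ 2 ∣ₛ X (suc m) - σ h
  X-mod = prime-power-cancel 2 _ pr p∤2 (subst (p ^ 2 ∣ₛ_) double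
      (∣m∣n⇒∣m+n (sum-single pair (suc m) h (s≤s h≤m) (λ k k<p → t-pair′ k (ℕ.≤-pred k<p)))
        (∣n⇒∣m*n (+ 2) (u-sign h h≤m))))
    where
    pair : ℕ → ℤ
    pair k = + 1 * t (suc m) k + + 1 * t (suc m) (m ℕ.∸ k)
    t-pair′ : ∀ k → k ≤ m → ¬ k ≡ h → p ^ 2 ∣ₛ pair k
    t-pair′ k k≤m k≢h = subst (p ^ 2 ∣ₛ_) (ones (t (suc m) k) (t (suc m) (m ℕ.∸ k))) (t-pair k k≤m k≢h)
      where
      ones : ∀ x y → x + y ≡ + 1 * x + + 1 * y
      ones = solve-∀
    total : sum pair (suc m) ≡ + 1 * X (suc m) + + 1 * X (suc m)
    total = trans (sum-linear₂ (+ 1) (+ 1) (t (suc m)) (λ k → t (suc m) (m ℕ.∸ k)) (suc m))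
      (cong (λ x → + 1 * X (suc m) + + 1 * x) (sym (sum-reverse (t (suc m)) m)))
    pair-h : pair h ≡ + 1 * u m h + + 1 * u m h
    pair-h = cong₂ (λ x y → + 1 * x + + 1 * y) t-h (trans (cong (t (suc m)) m∸h≡h) t-h)
    double : sum pair (suc m) - pair h + + 2 * (u m h - σ h) ≡ + 2 * (X (suc m) - σ h)
    double = trans (cong₂ (λ x y → x - y + + 2 * (u m h - σ h)) total pair-h) (step (X (suc m)) (u m h) (σ h))
      where
      step : ∀ x u s → + 1 * x + + 1 * x - (+ 1 * u + + 1 * u) + + 2 * (u - s) ≡ + 2 * (x - s)
      step = solve-∀

  S-mod : p ^ 3 ∣ₛ S (suc m) - (+ 12 * p * σ h - + 17 * p ^ 2)
  S-mod = prime-power-cancel 3 _ pr p∤18 (subst (p ^ 3 ∣ₛ_)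
      (trans (cong (_- + 18 * (+ 12 * p * σ h - + 17 * p ^ 2)) (sym (S-closed (suc m))))
        (sym (distrib (S (suc m)) (+ 12 * p * σ h - + 17 * p ^ 2))))
      (quadratic-mod p (X (suc m)) (D (suc m)) (G (suc m)) (σ h) (σ²≡1 h) X-mod G-mod D-G-mod))
    where
    distrib : ∀ x y → + 18 * (x - y) ≡ + 18 * x - + 18 * y
    distrib = solve-∀

theorem1p2 : (n p : ℕ) → 1 ≤ n → Prime p → 3 < p →
    ((+ n) ∣ (+ 9 * S n))
    × ((+ p) ^ 3 ∣ (S p - (+ 12 * + p * (-1ℤ ^ ((p ℕ.∸ 1) ℕ./ 2)) - + 17 * (+ p) ^ 2)))
theorem1p2 n (suc m) _ pr 3<p = ∣⇒∣ᵤ (n∣9S n) , ∣⇒∣ᵤ (S-mod m pr 3<p)
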